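{- Let $G=\langle V,E\rangle$ be a parity graph with total charge $c(G)=\top$. Then there are xor-assumptions $q_1,\dots,q_k$, a UP-refutation of $\operatorname{xorclauses}(G)\wedge q_1\wedge\dots\wedge q_k$, a node $v$ in this refutation with $L(v)=\bot$, and a cut $W=\langle V_a,V_b\rangle$ for $v$ such that the parity explanation of $v$ under $W$ satisfies $\mathit{Expl}_{\oplus}(v,W)=\top$. Thus $\operatorname{xorclauses}(G)\models(\top\Leftrightarrow\bot)$, showing that $\operatorname{xorclauses}(G)$ is unsatisfiable.
   Context: **Xor-clauses.** An atom is a propositional variable or the constant $\top$ (true); a literal is an atom or its negation; $\bot$ denotes $\neg\top$, and $\neg\neg A$ is $A$. An xor-clause is an expression $l_1\oplus\dots\oplus l_n$ of literals ($\oplus$ is exclusive or), always taken in normal form: each atom occurs at most once and all literals are positive. The normal form (unique up to reordering) is obtained by the rewrite rules $\neg A\oplus C\leadsto A\oplus\top\oplus C$ and $A\oplus A\oplus C\leadsto C$. The empty xor-clause $()$ is identified with $\bot$. An xor-clause is unary if it is $x$ or $x\oplus\top$ for a variable $x$; $x\oplus\top$ is identified with the literal $\neg x$. The expression $C[A/D]$ denotes the normal form of the xor-clause obtained from $C$ by substituting all occurrences of the atom $A$ with $D$. An xor-clause is satisfied by a truth assignment (total on its variables and making $\top$ true) iff an odd number of its literals are true. $\phi\models\phi'$ means that every truth assignment (to all variables involved) satisfying $\phi$ satisfies $\phi'$. **Parity graphs.** A parity graph is a (finite) undirected, connected, edge-labeled graph $G=\langle V,E\rangle$ where each node $v\in V$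 is labeled with a charge $c(v)\in\{\bot,\top\}$ and each edge is labeled with a distinct variable. The total charge is $c(G)=\bigoplus_{v\in V}c(v)$. For a node $v$, $\alpha(v)$ is the xor-clause $q_1\oplus\dots\oplus q_n\oplus c(v)\oplus\top$, where $q_1,\dots,q_n$ are the variables labeling the edges connected to $v$; and $\operatorname{xorclauses}(G)=\bigwedge_{v\in V}\alpha(v)$. **UP-derivations.** Let $\psi=\phi_{\mathrm{xor}}\wedge l_1\wedge\dots\wedge l_k$, where $\phi_{\mathrm{xor}}$ is a conjunction of xor-clauses and the $l_i$ (xor-assumptions) are literals over variables of $\phi_{\mathrm{xor}}$, viewed as unary xor-clauses. The inference rules are, for a variable $x$ and an xor-clause $C$ (in normal form) in which $x$ occurs: from $x$ and $C$ derive $C[x/\top]$; from $x\oplus\top$ and $C$ derive $C[x/\bot]$. A UP-derivation on $\psi$ is a finite vertex-labeled directed acyclic graph with vertex labels $L(v)$ that are xor-clauses, such that each vertex $v$ either has no incoming edges (an input vertex) and $L(v)$ is an xor-clause in $\psi$, or has exactly two incoming edges, originating from vertices $v_1,v_2$, and $L(v)$ is derived from $L(v_1)$ and $L(v_2)$ by one of the inference rules. A UP-refutation of $\psi$ is a UP-derivation on $\psi$ containing a vertex labeled with $\bot$. **Cuts.** A cut of a UP-derivation is a partitioning $(V_a,V_b)$ of its vertex set. A cut for a non-input vertex $v$ is a cut such that $v\in V_b$ and every input vertex from which there is a path to $v$ is in $V_a$. **Parity explanation.** For a node $v$ and a cut $W=\langle V_a,V_b\rangle$ for $v$ in a UP-derivation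 on $\phi_{\mathrm{xor}}\wedge l_1\wedge\dots\wedge l_k$, $\mathit{Expl}_{\oplus}(v,W)=f_W(v)$ (an xor-clause in normal form), where $f_W$ is defined recursively: (E1) if $u$ is an input node with $L(u)\in\phi_{\mathrm{xor}}$, then $f_W(u)=\top$; (E2) if $u$ is an input node with $L(u)\in\{l_1,\dots,l_k\}$, then $f_W(u)=L(u)$; (E3) if $u$ is a non-input node in $V_a$, then $f_W(u)=L(u)$; (E4) if $u$ is a non-input node in $V_b$, then $f_W(u)=f_W(u_1)\oplus f_W(u_2)\oplus\top$, where $u_1,u_2$ are the source nodes of the two edges incoming to $u$. Here $\phi_{\mathrm{xor}}=\operatorname{xorclauses}(G)$ and the assumptions are $q_1,\dots,q_k$.
   Formalization: The condition that W is a cut for v (so v is a non-input vertex) is claimed only if G has at least one edge: for a single node of charge ⊤ without edges there are no variables, hence no inference and no non-input vertex. Graphs have no loops. -}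

module Defs where

open import Data.Bool.Base using (Bool; true; false; if_then_else_; _xor_)
import Data.Bool.Properties as Bool
open import Data.Fin.Base using (Fin; zero; suc)
open import Data.Fin.Properties using (_≟_)
open import Data.Fin.Induction using (spo-wellFounded)
open import Data.Fin.Subset as Subset using (Subset; inside; ⁅_⁆; _∩_; ∁; ∣_∣)
open import Data.Fin.Subset.Properties as Subset using ()
open import Data.List.Base
  using (List; []; _∷_; _++_; [_]; map; filter; foldr; tabulate; allFin)
open import Data.List.Membership.Propositional using (_∈_)
import Data.List.Membership.DecPropositional as DecMembership
open import Data.List.Relation.Unary.All using (All)
open import Data.List.Relation.Unary.Any using (Any; here; there)
open import Data.Nat.Base using (ℕ; suc; _%_)
open import Data.Product.Base using (_×_; _,_; proj₁; proj₂; ∃; ∃-syntax)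
open import Data.Sum.Base using (_⊎_)
open import Data.Vec.Base using (Vec; zipWith)
import Data.Vec.Base as Vec
import Data.Vec.Properties as Vec
open import Function.Bundles using (_⇔_)
open import Function.Definitions using (Injective)
open import Induction.WellFounded using (Acc; acc; WellFounded)
open import Relation.Binary.Construct.Closure.ReflexiveTransitive using (Star)
open import Relation.Binary.Construct.Closure.Transitive as Plus using (TransClosure)
open import Relation.Binary.Definitions using (DecidableEquality)
open import Relation.Binary.PropositionalEquality
  using (_≡_; _≢_; refl; resp₂; isEquivalence)
open import Relation.Nullary using (¬_; Dec; does; yes; no)
open import Relation.Nullary.Decidable using (_⊎-dec_)

------------------------------------------------------------------------
-- Xor-clauses over the propositional variables Fin p

-- Atom zero is the constant ⊤; atom suc x is the variable x.

Atom : ℕ → Set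
Atom p = Fin (suc p)

⊤ᵃ : ∀ {p} → Atom p
⊤ᵃ = zero

var : ∀ {p} → Fin p → Atom p
var = suc

data Literal (p : ℕ) : Set where
  pos neg : Atom p → Literal p

atom : ∀ {p} → Literal p → Atom p
atom (pos A) = A
atom (neg A) = A

-- An xor-clause in normal form, up to reordering, is the finite set of its
-- atoms; the empty set is ().

XorClause : ℕ → Set
XorClause p = Subset (suc p)

_≟ᶜ_ : ∀ {p} → DecidableEquality (XorClause p)
_≟ᶜ_ = Vec.≡-dec Bool._≟_

⊥ᶜ ⊤ᶜ : ∀ {p} → XorClause p
⊥ᶜ = Subset.⊥
⊤ᶜ = ⁅ ⊤ᵃ ⁆

-- Symmetric difference: A ⊕ A ⊕ C ⇝ C.

infixr 5 _⊕_

_⊕_ : ∀ {p} → XorClause p → XorClause p → XorClause p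
_⊕_ = zipWith _xor_

⨁ : ∀ {p} → List (XorClause p) → XorClause p
⨁ = foldr _⊕_ ⊥ᶜ

-- ¬ A ⇝ A ⊕ ⊤

literal : ∀ {p} → Literal p → XorClause p
literal (pos A) = ⁅ A ⁆
literal (neg A) = ⁅ A ⁆ ⊕ ⊤ᶜ

normalForm : ∀ {p} → List (Literal p) → XorClause p
normalForm ls = ⨁ (map literal ls)

atoms : ∀ {p} → XorClause p → List (Atom p)
atoms C = filter (λ A → A Subset.∈? C) (allFin _)

_[_/_] : ∀ {p} → XorClause p → Atom p → XorClause p → XorClause p
C [ A / D ] = ⨁ (map (λ B → if does (B ≟ A) then D else ⁅ B ⁆) (atoms C))

-- A conjunction of xor-clauses.

Conjunction : ℕ → Set
Conjunction p = List (XorClause p)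

-- An assignment is the set of variables it makes true.

Assignment : ℕ → Set
Assignment p = Subset p

trueAtoms : ∀ {p} → Assignment p → Subset (suc p)
trueAtoms τ = inside Vec.∷ τ

infix 4 _⊨ᶜ_ _⊨_

_⊨ᶜ_ : ∀ {p} → Assignment p → XorClause p → Set
τ ⊨ᶜ C = ∣ C ∩ trueAtoms τ ∣ % 2 ≡ 1

Satisfies : ∀ {p} → Assignment p → Conjunction p → Set
Satisfies τ φ = All (τ ⊨ᶜ_) φ

-- Formulas, represented by their truth condition on assignments.

Formula : ℕ → Set₁
Formula p = Assignment p → Set

infix 5 _⇔ᶠ_

_⇔ᶠ_ : ∀ {p} → XorClause p → XorClause p → Formula p
(C ⇔ᶠ D) τ = (τ ⊨ᶜ C) ⇔ (τ ⊨ᶜ D)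

_⊨_ : ∀ {p} → Conjunction p → Formula p → Set
φ ⊨ F = ∀ τ → Satisfies τ φ → F τ

Unsatisfiable : ∀ {p} → Conjunction p → Set
Unsatisfiable φ = ¬ (∃[ τ ] Satisfies τ φ)

------------------------------------------------------------------------
-- Parity graphs

-- The order of the two endpoints is irrelevant. Parallel edges are allowed,
-- loops are not; a simple graph is the case of no parallel edges.
-- The charge ⊤ is true and the charge ⊥ is false.

record ParityGraph (p : ℕ) : Set where
  field
    #nodes #edges : ℕ
    ends          : Fin #edges → Fin #nodes × Fin #nodes
    loopless      : ∀ e → proj₁ (ends e) ≢ proj₂ (ends e)
    charge        : Fin #nodes → Bool
    label         : Fin #edges → Fin p
    label-inj     : Injective _≡_ _≡_ label

  Adjacent : Fin #nodes → Fin #nodes → Set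
  Adjacent u v = ∃[ e ] (ends e ≡ (u , v) ⊎ ends e ≡ (v , u))

  field
    connected : ∀ u v → Star Adjacent u v

  Incident : Fin #nodes → Fin #edges → Set
  Incident v e = v ≡ proj₁ (ends e) ⊎ v ≡ proj₂ (ends e)

  incident? : ∀ v e → Dec (Incident v e)
  incident? v e = (v ≟ proj₁ (ends e)) ⊎-dec (v ≟ proj₂ (ends e))

  incidentEdges : Fin #nodes → List (Fin #edges)
  incidentEdges v = filter (incident? v) (allFin #edges)

  chargeLiteral : Fin #nodes → Literal p
  chargeLiteral v = if charge v then pos ⊤ᵃ else neg ⊤ᵃ

  totalCharge : XorClause p
  totalCharge = normalForm (tabulate chargeLiteral)

  α : Fin #nodes → XorClause p
  α v = normalForm
    (map (λ e → pos (var (label e))) (incidentEdges v)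
      ++ chargeLiteral v ∷ pos ⊤ᵃ ∷ [])

  xorclauses : Conjunction p
  xorclauses = tabulate α

------------------------------------------------------------------------
-- UP-derivations

-- The literal is over a variable of φ.

IsAssumption : ∀ {p} → Conjunction p → Literal p → Set
IsAssumption φ l = ∃[ x ] (atom l ≡ var x × Any (λ C → var x Subset.∈ C) φ)

infixl 6 _∧ᵃ_

_∧ᵃ_ : ∀ {p} → Conjunction p → List (Literal p) → Conjunction p
φ ∧ᵃ ls = φ ++ map literal ls

-- Rule P C D: from P and C derive D.

data Rule {p : ℕ} : XorClause p → XorClause p → XorClause p → Set where
  ⊕-unit⁺ : ∀ {x C} → var x Subset.∈ C →
            Rule ⁅ var x ⁆ C (C [ var x / ⊤ᶜ ])
  ⊕-unit⁻ : ∀ {x C} → var x Subset.∈ C →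
            Rule (⁅ var x ⁆ ⊕ ⊤ᶜ) C (C [ var x / ⊥ᶜ ])

-- The incoming edges of a vertex, given by their sources.

data Incoming (n : ℕ) : Set where
  none : Incoming n
  two  : (v₁ v₂ : Fin n) → Incoming n

sources : ∀ {n} → Incoming n → List (Fin n)
sources none        = []
sources (two v₁ v₂) = v₁ ∷ v₂ ∷ []

Justified : ∀ {p n} → Conjunction p → (Fin n → XorClause p) →
            Incoming n → XorClause p → Set
Justified ψ L none        C = C ∈ ψ
Justified ψ L (two v₁ v₂) C = v₁ ≢ v₂ × Rule (L v₁) (L v₂) C

record UPDerivation {p : ℕ} (ψ : Conjunction p) : Set where
  field
    size     : ℕ
    incoming : Fin size → Incoming size
    L        : Fin size → XorClause p

  Vertex : Set
  Vertex = Fin size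

  infix 4 _⟶_

  _⟶_ : Vertex → Vertex → Set
  u ⟶ v = u ∈ sources (incoming v)

  field
    acyclic   : ∀ v → ¬ TransClosure _⟶_ v v
    justified : ∀ v → Justified ψ L (incoming v) (L v)

  IsInput : Vertex → Set
  IsInput v = incoming v ≡ none

  IsRefutation : Set
  IsRefutation = ∃[ v ] L v ≡ ⊥ᶜ

  ⟶-wellFounded : WellFounded _⟶_
  ⟶-wellFounded = Plus.wellFounded⁻ _⟶_ (spo-wellFounded record
    { isEquivalence = isEquivalence
    ; irrefl        = λ { refl → acyclic _ }
    ; trans         = Plus._++_
    ; <-resp-≈      = resp₂ _
    })

  -- A partition is given by its first part; the second is the complement.

  record Cut : Set where
    constructor cut
    field
      Vₐ : Subset size

    V_b : Subset size
    V_b = ∁ Vₐ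

  open Cut public

  record _IsCutFor_ (W : Cut) (v : Vertex) : Set where
    field
      nonInput : ¬ IsInput v
      v∈V_b    : v Subset.∈ V_b W
      inputs   : ∀ u → IsInput u → Star _⟶_ u v → u Subset.∈ Vₐ W

------------------------------------------------------------------------
-- Parity explanations

-- Where an input label lies both in φ and among the assumptions, the clause
-- for φ takes precedence.

module _ {p : ℕ} (φ : Conjunction p) (ls : List (Literal p))
         (𝒟 : UPDerivation (φ ∧ᵃ ls)) where
  open UPDerivation 𝒟
  open DecMembership (_≟ᶜ_ {p}) using (_∈?_)

  mutual
    explain : Cut → (u : Vertex) → Acc _⟶_ u → XorClause p
    explain W u (acc rs) = explainBy W u (incoming u) rs

    explainBy : Cut → Vertex → (i : Incoming size) →
                (∀ {w} → w ∈ sources i → Acc _⟶_ w) → XorClause p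
    explainBy W u none rs with L u ∈? φ
    ... | yes _ = ⊤ᶜ
    ... | no  _ = L u
    explainBy W u (two u₁ u₂) rs with u Subset.∈? Vₐ W
    ... | yes _ = L u
    ... | no  _ = explain W u₁ (rs (here refl))
                    ⊕ explain W u₂ (rs (there (here refl)))
                    ⊕ ⊤ᶜ

  Expl⊕ : Vertex → Cut → XorClause p
  Expl⊕ v W = explain W v (⟶-wellFounded v)

{-# OPTIONS --safe #-}
-- Fix a root r. Flipping edge values along paths to r, we find values τ that satisfy α(v)
-- at every node v ≠ r; by the total charge, α(r) is then violated. Assume the literal given
-- by τ for every edge. Propagating the edges at r refutes α(r), and propagating all edges
-- but e at a node v ≠ r derives the literal of e from α(v). Starting with S = {r}, keep a
-- refutation that cites the literal of an edge an odd number of times exactly when one end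
-- of the edge lies in S: to add a neighbour w of S along e, replace the citations of e by
-- its derivation from α(w). When S is the whole graph, every literal is cited an even
-- number of times. For the cut separating the input vertices from all others, the
-- explanation of ⊥, up to a summand ⊤, is a sum over citations, so it is ⊤.
--
-- The replacement is harmless because refutations may be taken to be trees: nothing forbids
-- several input vertices with the same label.
module Submission where

open import Defs
open import Data.Bool.Base using (Bool; true; false; not; if_then_else_; _∧_; _xor_)
open import Data.Bool.Properties
  using (∧-distribʳ-xor; ∧-identityʳ; ∧-zeroʳ; not-involutive; not-¬; xor-assoc; xor-comm;
         xor-identityʳ; xor-same)
open import Data.Bool.Solver using (module xor-∧-Solver)
open import Data.Empty using (⊥-elim)
open import Data.Fin.Base as Fin using (Fin; zero; suc; _↑ˡ_; _↑ʳ_; fromℕ<; splitAt)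
open import Data.Fin.Properties as Fin
  using (_≟_; join-splitAt; splitAt-↑ˡ; splitAt-↑ʳ; suc-injective; toℕ-↑ˡ; toℕ-↑ʳ;
         ↑ˡ-injective; ↑ʳ-injective)
open import Data.Fin.Subset as Subset using (_∩_; ∣_∣)
open import Data.Fin.Subset.Properties using (x∉p⇒x∈∁p) renaming (_∈?_ to _∈ˢ?_)
open import Data.List.Base
  using (List; []; _∷_; _++_; map; filter; foldr; tabulate; allFin)
import Data.List.Membership.DecPropositional as DecMembership
open import Data.List.Membership.Propositional using (_∈_)
open import Data.List.Membership.Propositional.Properties
  using (∈-++⁺ˡ; ∈-++⁺ʳ; ∈-allFin; ∈-filter⁻; ∈-map⁺; ∈-tabulate⁺; ∈-tabulate⁻)
open import Data.List.Properties using (map-∘; map-tabulate)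
open import Data.List.Relation.Unary.All as All using (All; []; _∷_)
import Data.List.Relation.Unary.All.Properties as All
open import Data.List.Relation.Unary.AllPairs using ([]; _∷_)
open import Data.List.Relation.Unary.Any using (here; there)
import Data.List.Relation.Unary.Any.Properties as Any
open import Data.List.Relation.Unary.Unique.Propositional using (Unique)
open import Data.List.Relation.Unary.Unique.Propositional.Properties using (allFin⁺; filter⁺)
open import Data.Nat.Base using (ℕ; zero; suc; _+_; _<_; _%_; s≤s; z≤n)
import Data.Nat.Properties as ℕ
open import Data.Product.Base using (Σ; Σ-syntax; ∃-syntax; _×_; _,_; proj₁; proj₂)
open import Data.Sum.Base using (_⊎_; inj₁; inj₂; [_,_]′; swap)
open import Data.Vec.Base as Vec using (Vec; lookup; replicate)
open import Data.Vec.Properties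
  using ([]=⇒lookup; lookup-replicate; lookup-zipWith; lookup∘tabulate; lookup⇒[]=;
         tabulate-cong; tabulate∘lookup; zipWith-assoc; zipWith-comm)
open import Function.Base using (_∘_; id)
open import Function.Definitions using (Injective)
open import Induction.WellFounded using (Acc; acc)
open import Relation.Binary.Construct.Closure.ReflexiveTransitive using (Star; ε; _◅_)
open import Relation.Binary.Construct.Closure.Transitive as Plus using (TransClosure)
open import Relation.Binary.PropositionalEquality
open import Relation.Nullary using (¬_; does; yes; no; contradiction)
open import Relation.Nullary.Decidable using (dec-true; dec-false; ¬?)
open import Relation.Unary using (Decidable)

open xor-∧-Solver using (solve; con; _:+_; _:*_; _:=_)

-- Sums modulo 2

∑ : {A : Set} → List A → (A → Bool) → Bool
∑ xs h = foldr _xor_ false (map h xs)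

infixr 5 ∑
syntax ∑ xs (λ x → b) = ∑[ x ← xs ] b

module _ {A : Set} where

  ∑-cong : {g h : A → Bool} → g ≗ h → ∀ xs → ∑ xs g ≡ ∑ xs h
  ∑-cong g≗h []       = refl
  ∑-cong g≗h (x ∷ xs) = cong₂ _xor_ (g≗h x) (∑-cong g≗h xs)

  ∑-false : ∀ (xs : List A) → ∑[ x ← xs ] false ≡ false
  ∑-false []       = refl
  ∑-false (x ∷ xs) = ∑-false xs

  ∑-xor : ∀ (g h : A → Bool) xs → ∑[ x ← xs ] (g x xor h x) ≡ ∑ xs g xor ∑ xs h
  ∑-xor g h []       = refl
  ∑-xor g h (x ∷ xs) =
    trans (cong ((g x xor h x) xor_) (∑-xor g h xs))
      (solve 4 (λ a b c d → (a :+ b) :+ (c :+ d) := (a :+ c) :+ (b :+ d)) refl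
        (g x) (h x) (∑ xs g) (∑ xs h))

  ∑-++ : ∀ (h : A → Bool) xs ys → ∑ (xs ++ ys) h ≡ ∑ xs h xor ∑ ys h
  ∑-++ h []       ys = refl
  ∑-++ h (x ∷ xs) ys =
    trans (cong (h x xor_) (∑-++ h xs ys))
      (solve 3 (λ a b c → a :+ (b :+ c) := (a :+ b) :+ c) refl
        (h x) (∑ xs h) (∑ ys h))

  ∑-filter : ∀ {P : A → Set} (P? : Decidable P) (h : A → Bool) xs →
             ∑ (filter P? xs) h ≡ ∑[ x ← xs ] (does (P? x) ∧ h x)
  ∑-filter P? h []       = refl
  ∑-filter P? h (x ∷ xs) with does (P? x)
  ... | true  = cong (h x xor_) (∑-filter P? h xs)
  ... | false = ∑-filter P? h xs

  ∑-map : ∀ {B : Set} (f : B → A) (h : A → Bool) xs → ∑ (map f xs) h ≡ ∑ xs (h ∘ f)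
  ∑-map f h xs = cong (foldr _xor_ false) (sym (map-∘ xs))

  ∑-∧ : ∀ (h : A → Bool) b xs → ∑[ x ← xs ] (h x ∧ b) ≡ ∑ xs h ∧ b
  ∑-∧ h b []       = refl
  ∑-∧ h b (x ∷ xs) =
    trans (cong ((h x ∧ b) xor_) (∑-∧ h b xs)) (sym (∧-distribʳ-xor b (h x) (∑ xs h)))

  ∑-all-false : ∀ {h : A → Bool} {xs} → All (λ x → h x ≡ false) xs → ∑ xs h ≡ false
  ∑-all-false []         = refl
  ∑-all-false (eq ∷ eqs) = cong₂ _xor_ eq (∑-all-false eqs)

∑-comm : ∀ {A B : Set} (h : A → B → Bool) xs ys →
         ∑[ x ← xs ] ∑[ y ← ys ] h x y ≡ ∑[ y ← ys ] ∑[ x ← xs ] h x y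
∑-comm h []       ys = sym (∑-false ys)
∑-comm h (x ∷ xs) ys =
  trans (cong (∑ ys (h x) xor_) (∑-comm h xs ys)) (sym (∑-xor (h x) _ ys))

δ : ∀ {n} → Fin n → Fin n → Bool
δ i j = does (i ≟ j)

δ-sym : ∀ {n} (i j : Fin n) → δ i j ≡ δ j i
δ-sym i j with i ≟ j
... | yes refl = sym (dec-true (i ≟ i) refl)
... | no  i≢j  = sym (dec-false (j ≟ i) (i≢j ∘ sym))

δ-injective : ∀ {m n} {f : Fin m → Fin n} → Injective _≡_ _≡_ f → ∀ i j → δ (f i) (f j) ≡ δ i j
δ-injective {f = f} inj i j with i ≟ j
... | yes refl = dec-true (f i ≟ f i) refl
... | no  i≢j  = dec-false (f i ≟ f j) (i≢j ∘ inj)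

∑-δ : ∀ {n} (i : Fin n) (h : Fin n → Bool) → ∑[ j ← allFin n ] (δ j i ∧ h j) ≡ h i
∑-δ {suc n} i h =
  trans (cong (λ js → (δ zero i ∧ h zero) xor ∑ js (λ j → δ j i ∧ h j))
          (sym (map-tabulate id suc)))
    (trans (cong ((δ zero i ∧ h zero) xor_) (∑-map suc _ (allFin n))) (split i))
  where
  split : ∀ i → (δ zero i ∧ h zero) xor (∑[ j ← allFin n ] (δ (suc j) i ∧ h (suc j))) ≡ h i
  split zero    = trans (cong (h zero xor_) (∑-false (allFin n))) (xor-identityʳ _)
  split (suc i) = ∑-δ i (h ∘ suc)

∑-filter-δ∧ : ∀ {n} {P : Fin n → Set} (P? : Decidable P) i (h : Fin n → Bool) →
              ∑[ j ← filter P? (allFin n) ] (δ j i ∧ h j) ≡ does (P? i) ∧ h i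
∑-filter-δ∧ {n} P? i h =
  trans (∑-filter P? _ (allFin n))
    (trans (∑-cong (λ j → solve 3 (λ a b c → a :* (b :* c) := b :* (a :* c)) refl
             (does (P? j)) (δ j i) (h j)) (allFin n))
      (∑-δ i (λ j → does (P? j) ∧ h j)))

∑-filter-δ : ∀ {n} {P : Fin n → Set} (P? : Decidable P) i →
             ∑[ j ← filter P? (allFin n) ] δ j i ≡ does (P? i)
∑-filter-δ {n} P? i =
  trans (∑-cong (λ j → sym (∧-identityʳ (δ j i))) (filter P? (allFin n)))
    (trans (∑-filter-δ∧ P? i (λ _ → true)) (∧-identityʳ (does (P? i))))

-- Modulo 2, deleting a summand amounts to adding it a second time.
∑-remove : ∀ {n} {P : Fin n → Set} (P? : Decidable P) i (h : Fin n → Bool) → does (P? i) ≡ true →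
           ∑ (filter (λ j → ¬? (j ≟ i)) (filter P? (allFin n))) h ≡
           ∑ (filter P? (allFin n)) h xor h i
∑-remove {n} P? i h Pi =
  trans (∑-filter (λ j → ¬? (j ≟ i)) h js)
    (trans (∑-cong (λ j → complement (δ j i) (h j)) js)
      (trans (∑-xor h (λ j → δ j i ∧ h j) js)
        (cong (∑ js h xor_) (trans (∑-filter-δ∧ P? i h) (cong (_∧ h i) Pi)))))
  where
  js : List (Fin n)
  js = filter P? (allFin n)
  complement : ∀ a b → not a ∧ b ≡ b xor (a ∧ b)
  complement true  b = sym (xor-same b)
  complement false b = sym (xor-identityʳ b)

-- Xor-clauses as vectors over the field with two elements

lookup-ext : ∀ {n} {A : Set} {xs ys : Vec A n} → lookup xs ≗ lookup ys → xs ≡ ys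
lookup-ext {xs = xs} {ys} eq =
  trans (sym (tabulate∘lookup xs)) (trans (tabulate-cong eq) (tabulate∘lookup ys))

module _ {p : ℕ} where

  lookup-⊕ : ∀ i (C D : XorClause p) → lookup (C ⊕ D) i ≡ lookup C i xor lookup D i
  lookup-⊕ = lookup-zipWith _xor_

  -- Used for two functionals: the coordinates of a clause (`lookup-linear`) and its truth value
  -- under an assignment (`value-linear`). The clauses `α v` and `totalCharge` are evaluated once
  -- for both.
  record Linear (ev : XorClause p → Bool) : Set where
    field
      ev-⊥ : ev ⊥ᶜ ≡ false
      ev-⊕ : ∀ C D → ev (C ⊕ D) ≡ ev C xor ev D

    ev-⨁ : ∀ {A : Set} (f : A → XorClause p) xs → ev (⨁ (map f xs)) ≡ ∑ xs (ev ∘ f)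
    ev-⨁ f []       = ev-⊥
    ev-⨁ f (x ∷ xs) = trans (ev-⊕ (f x) _) (cong (ev (f x) xor_) (ev-⨁ f xs))

  lookup-linear : ∀ a → Linear (λ C → lookup C a)
  lookup-linear a = record
    { ev-⊥ = lookup-replicate a false
    ; ev-⊕ = lookup-⊕ a
    }

lookup-⁅⁆ : ∀ {n} (i j : Fin n) → lookup Subset.⁅ i ⁆ j ≡ δ i j
lookup-⁅⁆ zero    zero    = refl
lookup-⁅⁆ zero    (suc j) = lookup-replicate j false
lookup-⁅⁆ (suc i) zero    = refl
lookup-⁅⁆ (suc i) (suc j) = lookup-⁅⁆ i j

does-∈? : ∀ {n} (i : Fin n) (C : Subset.Subset n) → does (i ∈ˢ? C) ≡ lookup C i
does-∈? zero    (true  Vec.∷ C) = refl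
does-∈? zero    (false Vec.∷ C) = refl
does-∈? (suc i) (b Vec.∷ C)     = does-∈? i C

⊕-self : ∀ {n} (C : Vec Bool n) → Vec.zipWith _xor_ C C ≡ replicate n false
⊕-self Vec.[]      = refl
⊕-self (b Vec.∷ C) = cong₂ Vec._∷_ (xor-same b) (⊕-self C)

module _ {p : ℕ} where

  ⊕-assoc : ∀ (C D E : XorClause p) → (C ⊕ D) ⊕ E ≡ C ⊕ D ⊕ E
  ⊕-assoc = zipWith-assoc xor-assoc

  ⊕-comm : ∀ (C D : XorClause p) → C ⊕ D ≡ D ⊕ C
  ⊕-comm = zipWith-comm xor-comm

  ⊕-swap : ∀ (C D E : XorClause p) → C ⊕ D ⊕ E ≡ D ⊕ C ⊕ E
  ⊕-swap C D E =
    trans (sym (⊕-assoc C D E)) (trans (cong (_⊕ E) (⊕-comm C D)) (⊕-assoc D C E))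

  ⊕-cancel : ∀ (C D E : XorClause p) → (D ⊕ E) ⊕ C ⊕ E ≡ C ⊕ D ⊕ ⊥ᶜ
  ⊕-cancel C D E =
    trans (⊕-swap (D ⊕ E) C E)
      (cong (C ⊕_) (trans (⊕-assoc D E E) (cong (D ⊕_) (⊕-self E))))

  -- Modulo 2, replacing B by ⁅ B ⁆ changes nothing and replacing A by D adds ⁅ A ⁆ ⊕ D.
  substitution : ∀ {A} {C : XorClause p} (D : XorClause p) → A Subset.∈ C →
                 C [ A / D ] ≡ C ⊕ Subset.⁅ A ⁆ ⊕ D
  substitution {A} {C} D A∈C = lookup-ext λ i → begin
    lookup (C [ A / D ]) i
      ≡⟨ Linear.ev-⨁ (lookup-linear i) f (atoms C) ⟩
    ∑ (atoms C) (λ B → lookup (f B) i)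
      ≡⟨ ∑-filter (_∈ˢ? C) _ (allFin _) ⟩
    ∑ (allFin _) (λ B → does (B ∈ˢ? C) ∧ lookup (f B) i)
      ≡⟨ ∑-cong (λ B → step i B) (allFin _) ⟩
    ∑ (allFin _) (λ B → (δ B i ∧ lookup C B) xor (δ B A ∧ (lookup C B ∧ z i)))
      ≡⟨ ∑-xor (λ B → δ B i ∧ lookup C B) (λ B → δ B A ∧ (lookup C B ∧ z i)) (allFin _) ⟩
    ∑ (allFin _) (λ B → δ B i ∧ lookup C B) xor
    ∑ (allFin _) (λ B → δ B A ∧ (lookup C B ∧ z i))
      ≡⟨ cong₂ _xor_ (∑-δ i (lookup C)) (∑-δ A (λ B → lookup C B ∧ z i)) ⟩
    lookup C i xor (lookup C A ∧ z i)
      ≡⟨ cong (λ b → lookup C i xor (b ∧ z i)) ([]=⇒lookup A∈C) ⟩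
    lookup C i xor z i
      ≡⟨ cong (lookup C i xor_) (cong (_xor lookup D i) (sym (lookup-⁅⁆ A i))) ⟩
    lookup C i xor (lookup Subset.⁅ A ⁆ i xor lookup D i)
      ≡⟨ cong (lookup C i xor_) (sym (lookup-⊕ i Subset.⁅ A ⁆ D)) ⟩
    lookup C i xor lookup (Subset.⁅ A ⁆ ⊕ D) i
      ≡⟨ sym (lookup-⊕ i C _) ⟩
    lookup (C ⊕ Subset.⁅ A ⁆ ⊕ D) i ∎
    where
    open ≡-Reasoning
    f : Atom p → XorClause p
    f B = if does (B ≟ A) then D else Subset.⁅ B ⁆
    z : Atom p → Bool
    z i = δ A i xor lookup D i
    step : ∀ i B → does (B ∈ˢ? C) ∧ lookup (f B) i ≡
                   (δ B i ∧ lookup C B) xor (δ B A ∧ (lookup C B ∧ z i))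
    step i B with B ≟ A
    ... | no  _    = trans (cong₂ _∧_ (does-∈? B C) (lookup-⁅⁆ B i))
      (solve 2 (λ c d → c :* d := d :* c :+ con false) refl (lookup C B) (δ B i))
    ... | yes refl = trans (cong (_∧ lookup D i) (does-∈? B C))
      (solve 3 (λ c d e → c :* e := d :* c :+ c :* (d :+ e)) refl
        (lookup C B) (δ B i) (lookup D i))

  signed : Bool → Fin p → Literal p
  signed b x = if b then pos (var x) else neg (var x)

  -- Both inference rules add the unit premise and `⊤ᶜ` to the clause, whatever the sign of the
  -- literal. A conclusion thus depends on its premises just as the explanation of an inner vertex
  -- depends on those of its sources.
  rule : ∀ b x {C : XorClause p} → var x Subset.∈ C →
         Rule (literal (signed b x)) C (literal (signed b x) ⊕ C ⊕ ⊤ᶜ)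
  rule true  x {C} x∈C =
    subst (Rule _ _) (trans (substitution ⊤ᶜ x∈C) (⊕-swap C Subset.⁅ var x ⁆ ⊤ᶜ)) (⊕-unit⁺ x∈C)
  rule false x {C} x∈C =
    subst (Rule _ _) (trans (substitution ⊥ᶜ x∈C) (sym (⊕-cancel C Subset.⁅ var x ⁆ ⊤ᶜ))) (⊕-unit⁻ x∈C)

-- Satisfaction of a clause as a linear functional

odd : ℕ → Bool
odd zero    = false
odd (suc n) = not (odd n)

%2≡1⇒odd : ∀ n → n % 2 ≡ 1 → odd n ≡ true
%2≡1⇒odd 1             _  = refl
%2≡1⇒odd (suc (suc n)) eq = trans (not-involutive (odd n)) (%2≡1⇒odd n eq)

odd-∣∩∣ : ∀ {n} (C D : Subset.Subset n) →
          odd ∣ C ∩ D ∣ ≡ ∑[ i ← allFin n ] (lookup C i ∧ lookup D i)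
odd-∣∩∣ Vec.[] Vec.[] = refl
odd-∣∩∣ {suc n} (b Vec.∷ C) (c Vec.∷ D) =
  trans (head (b ∧ c))
    (cong ((b ∧ c) xor_)
      (trans (odd-∣∩∣ C D)
        (trans (sym (∑-map suc (λ i → lookup (b Vec.∷ C) i ∧ lookup (c Vec.∷ D) i) (allFin n)))
          (cong (λ is → ∑ is (λ i → lookup (b Vec.∷ C) i ∧ lookup (c Vec.∷ D) i))
            (map-tabulate id suc)))))
  where
  head : ∀ a → odd ∣ a Vec.∷ C ∩ D ∣ ≡ a xor odd ∣ C ∩ D ∣
  head true  = refl
  head false = refl

module _ {p : ℕ} where

  -- Satisfaction is a cardinality modulo 2; written as an inner product with `trueAtoms τ`, it
  -- becomes linear in the clause.
  value : Assignment p → XorClause p → Bool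
  value τ C = ∑[ a ← allFin _ ] (lookup C a ∧ lookup (trueAtoms τ) a)

  value-linear : ∀ τ → Linear (value τ)
  value-linear τ = record
    { ev-⊥ = trans (∑-cong (λ a → cong (_∧ lookup (trueAtoms τ) a) (lookup-replicate a false))
                     (allFin _))
               (∑-false (allFin (suc p)))
    ; ev-⊕ = λ C D →
        trans (∑-cong (λ a → trans (cong (_∧ lookup (trueAtoms τ) a) (lookup-⊕ a C D))
                               (∧-distribʳ-xor (lookup (trueAtoms τ) a) (lookup C a) (lookup D a)))
                (allFin _))
          (∑-xor (λ a → lookup C a ∧ lookup (trueAtoms τ) a)
                 (λ a → lookup D a ∧ lookup (trueAtoms τ) a) (allFin _))
    }

  value-⁅⁆ : ∀ τ A → value τ Subset.⁅ A ⁆ ≡ lookup (trueAtoms τ) A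
  value-⁅⁆ τ A =
    trans (∑-cong (λ a → cong (_∧ lookup (trueAtoms τ) a)
                           (trans (lookup-⁅⁆ A a) (δ-sym A a))) (allFin _))
      (∑-δ A (lookup (trueAtoms τ)))

  ⊨ᶜ⇒value : ∀ {τ} {C : XorClause p} → τ ⊨ᶜ C → value τ C ≡ true
  ⊨ᶜ⇒value {τ} {C} sat = trans (sym (odd-∣∩∣ C (trueAtoms τ))) (%2≡1⇒odd ∣ C ∩ trueAtoms τ ∣ sat)

  -- The coefficient of `⊤ᵃ` is the negation of `b`, written `b xor true` so that the ring solver
  -- can treat it as a polynomial.
  lookup-signed : ∀ b (x : Fin p) a → lookup (literal (signed b x)) a ≡
                            δ (var x) a xor ((b xor true) ∧ δ ⊤ᵃ a)
  lookup-signed true  x a = trans (lookup-⁅⁆ (var x) a) (sym (xor-identityʳ _))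
  lookup-signed false x a =
    trans (lookup-⊕ a Subset.⁅ var x ⁆ ⊤ᶜ) (cong₂ _xor_ (lookup-⁅⁆ (var x) a) (lookup-⁅⁆ ⊤ᵃ a))

-- Proof trees and UP-derivations

relocate : ∀ {m n} → (Fin m → Fin n) → Incoming m → Incoming n
relocate ι none      = none
relocate ι (two u v) = two (ι u) (ι v)

two≢none : ∀ {n} {u v : Fin n} → two u v ≢ none
two≢none ()

relocate-∘ : ∀ {l m n} (κ : Fin m → Fin n) (ι : Fin l → Fin m) x →
             relocate κ (relocate ι x) ≡ relocate (κ ∘ ι) x
relocate-∘ κ ι none      = refl
relocate-∘ κ ι (two u v) = refl

relocate-id : ∀ {n} (x : Incoming n) → relocate id x ≡ x
relocate-id none      = refl
relocate-id (two u v) = refl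

module _ {m : ℕ} (n : ℕ) where

  -- Layout of the tree of an inference: the conclusion is vertex `zero`, followed by the block of
  -- the first premise and then by that of the second. Both embeddings preserve the order.
  left : Fin m → Fin (suc (m + n))
  left i = suc (i ↑ˡ n)

  left-injective : Injective _≡_ _≡_ left
  left-injective = ↑ˡ-injective n _ _ ∘ suc-injective

  left-mono-< : ∀ {i j} → i Fin.< j → left i Fin.< left j
  left-mono-< {i} {j} i<j =
    s≤s (subst₂ _<_ (sym (toℕ-↑ˡ i n)) (sym (toℕ-↑ˡ j n)) i<j)

module _ (m : ℕ) {n : ℕ} where

  right : Fin n → Fin (suc (m + n))
  right j = suc (m ↑ʳ j)

  right-injective : Injective _≡_ _≡_ right
  right-injective = ↑ʳ-injective m _ _ ∘ suc-injective

  right-mono-< : ∀ {i j} → i Fin.< j → right i Fin.< right j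
  right-mono-< {i} {j} i<j =
    s≤s (subst₂ _<_ (sym (toℕ-↑ʳ m i)) (sym (toℕ-↑ʳ m j)) (ℕ.+-monoʳ-< m i<j))

module _ (m n : ℕ) where

  left≢right : ∀ {i j} → left {m} n i ≢ right m {n} j
  left≢right {i} {j} eq
    with () ← trans (sym (splitAt-↑ˡ m i n))
                (trans (cong (splitAt m) (suc-injective eq)) (splitAt-↑ʳ m n j))

  branch : {A : Set} → A → (Fin m → A) → (Fin n → A) → Fin (suc (m + n)) → A
  branch a f g zero    = a
  branch a f g (suc v) = [ f , g ]′ (splitAt m v)

  branch-left : ∀ {A : Set} (a : A) f g i → branch a f g (left n i) ≡ f i
  branch-left a f g i = cong [ f , g ]′ (splitAt-↑ˡ m i n)

  branch-right : ∀ {A : Set} (a : A) f g j → branch a f g (right m j) ≡ g j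
  branch-right a f g j = cong [ f , g ]′ (splitAt-↑ʳ m n j)

  branch-elim : (P : Fin (suc (m + n)) → Set) →
                P zero → (∀ i → P (left n i)) → (∀ j → P (right m j)) → ∀ v → P v
  branch-elim P z l r zero    = z
  branch-elim P z l r (suc v) with splitAt m v | join-splitAt m n v
  ... | inj₁ i | refl = l i
  ... | inj₂ j | refl = r j

module Refutations {p k : ℕ} (φ : Conjunction p) (q : Fin k → Literal p) where

  open DecMembership (_≟ᶜ_ {p}) using (_∈?_)

  assumptions : List (Literal p)
  assumptions = tabulate q

  ψ : Conjunction p
  ψ = φ ∧ᵃ assumptions

  data Proof : XorClause p → Set where
    axiom  : ∀ {C} → C ∈ φ → Proof C
    assume : ∀ i → Proof (literal (q i))
    infer  : ∀ {P C D} → Proof P → Proof C → Rule P C D → Proof D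

  -- Only the parity of the citations is kept, because explanations are sums modulo 2. An `axiom`
  -- leaf counts for nothing, even if its clause happens to equal an assumption.
  uses : ∀ {C} → Proof C → Fin k → Bool
  uses (axiom _)     i = false
  uses (assume j)    i = δ j i
  uses (infer π ρ _) i = uses π i xor uses ρ i

  uses-subst : ∀ {C D} (eq : C ≡ D) (π : Proof C) i → uses (subst Proof eq π) i ≡ uses π i
  uses-subst refl π i = refl

  -- The label of an assumption can also be a clause of `φ`, as it is at a balanced node of degree
  -- one; the membership test follows the precedence fixed in `explainBy`.
  leafExplanation : XorClause p → XorClause p
  leafExplanation C = if does (C ∈? φ) then ⊤ᶜ else C

  explanation : ∀ {C} → Proof C → XorClause p
  explanation (axiom _)     = ⊤ᶜ
  explanation (assume i)    = leafExplanation (literal (q i))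
  explanation (infer π ρ _) = explanation π ⊕ explanation ρ ⊕ ⊤ᶜ

  substitute : ∀ {C} i → Proof (literal (q i)) → Proof C → Proof C
  substitute i ρ (axiom C∈φ) = axiom C∈φ
  substitute i ρ (assume j) with j ≟ i
  ... | yes refl = ρ
  ... | no  _    = assume j
  substitute i ρ (infer π π′ r) = infer (substitute i ρ π) (substitute i ρ π′) r

  -- Every citation of `i` is exchanged for the citations made by `ρ`, a change of
  -- `δ i j xor uses ρ j` each time. Modulo 2 these changes amount to one if `i` is cited an odd
  -- number of times and to none otherwise.
  uses-substitute : ∀ {C} i (ρ : Proof (literal (q i))) (π : Proof C) j →
                    uses (substitute i ρ π) j ≡ uses π j xor (uses π i ∧ (δ i j xor uses ρ j))
  uses-substitute i ρ (axiom _) j = refl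
  uses-substitute i ρ (assume h) j with h ≟ i
  ... | yes refl = solve 2 (λ a b → b := a :+ (a :+ b)) refl (δ h j) (uses ρ j)
  ... | no  _    = solve 1 (λ a → a := a :+ con false) refl (δ h j)
  uses-substitute i ρ (infer π π′ _) j =
    trans (cong₂ _xor_ (uses-substitute i ρ π j) (uses-substitute i ρ π′ j))
      (solve 5 (λ a b a′ b′ c → (a :+ b :* c) :+ (a′ :+ b′ :* c) :=
                                (a :+ a′) :+ (b :+ b′) :* c) refl
        (uses π j) (uses π i) (uses π′ j) (uses π′ i) (δ i j xor uses ρ j))

  -- With `⊤ᶜ` added, the explanation of an inference is the sum of those of its premises, and that
  -- of an axiom is zero. So it is a sum over cited assumptions, in which only the parity of the
  -- citations matters.
  lookup-explanation : ∀ {C} (π : Proof C) a → lookup (explanation π) a ≡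
    lookup {n = suc p} ⊤ᶜ a xor
    ∑ (allFin k) (λ i → uses π i ∧ (lookup ⊤ᶜ a xor lookup (leafExplanation (literal (q i))) a))
  lookup-explanation (axiom _) a = sym
    (trans (cong (lookup ⊤ᶜ a xor_) (∑-false (allFin k)))
      (solve 1 (λ t → t :+ con false := t) refl (lookup ⊤ᶜ a)))
  lookup-explanation (assume i) a = sym (begin
    t xor ∑ (allFin k) (λ j → δ i j ∧ (t xor e j))
      ≡⟨ cong (t xor_) (∑-cong (λ j → cong (_∧ (t xor e j)) (δ-sym i j)) (allFin k)) ⟩
    t xor ∑ (allFin k) (λ j → δ j i ∧ (t xor e j))
      ≡⟨ cong (t xor_) (∑-δ i (λ j → t xor e j)) ⟩
    t xor (t xor e i)
      ≡⟨ solve 2 (λ t e → t :+ (t :+ e) := e) refl t (e i) ⟩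
    e i ∎)
    where
    open ≡-Reasoning
    t : Bool
    t = lookup {n = suc p} ⊤ᶜ a
    e : Fin k → Bool
    e i = lookup (leafExplanation (literal (q i))) a
  lookup-explanation (infer π ρ _) a = begin
    lookup (explanation π ⊕ explanation ρ ⊕ ⊤ᶜ) a
      ≡⟨ lookup-⊕ a (explanation π) _ ⟩
    lookup (explanation π) a xor lookup (explanation ρ ⊕ ⊤ᶜ) a
      ≡⟨ cong (lookup (explanation π) a xor_) (lookup-⊕ a (explanation ρ) ⊤ᶜ) ⟩
    lookup (explanation π) a xor (lookup (explanation ρ) a xor t)
      ≡⟨ cong₂ (λ b c → b xor (c xor t)) (lookup-explanation π a) (lookup-explanation ρ a) ⟩
    (t xor s π) xor ((t xor s ρ) xor t)
      ≡⟨ solve 3 (λ t x y → (t :+ x) :+ ((t :+ y) :+ t) := t :+ (x :+ y)) refl t (s π) (s ρ) ⟩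
    t xor (s π xor s ρ)
      ≡⟨ cong (t xor_) (sym (∑-xor (λ i → uses π i ∧ e i) (λ i → uses ρ i ∧ e i) (allFin k))) ⟩
    t xor ∑ (allFin k) (λ i → (uses π i ∧ e i) xor (uses ρ i ∧ e i))
      ≡⟨ cong (t xor_) (∑-cong (λ i → sym (∧-distribʳ-xor (e i) (uses π i) (uses ρ i))) (allFin k)) ⟩
    t xor ∑ (allFin k) (λ i → (uses π i xor uses ρ i) ∧ e i) ∎
    where
    open ≡-Reasoning
    t : Bool
    t = lookup {n = suc p} ⊤ᶜ a
    e : Fin k → Bool
    e i = t xor lookup (leafExplanation (literal (q i))) a
    s : ∀ {C} → Proof C → Bool
    s π = ∑ (allFin k) (λ i → uses π i ∧ e i)

  explanation-even : ∀ {C} (π : Proof C) → (∀ i → uses π i ≡ false) → explanation π ≡ ⊤ᶜ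
  explanation-even π even = lookup-ext λ a →
    trans (lookup-explanation π a)
      (trans (cong (lookup ⊤ᶜ a xor_)
               (trans (∑-cong (λ i → cong (_∧ _) (even i)) (allFin k)) (∑-false (allFin k))))
        (solve 1 (λ t → t :+ con false := t) refl (lookup ⊤ᶜ a)))

  -- Proof trees laid out as UP-derivations

  mutual
    -- Split into a successor and `inner` so that `zero` is a vertex, the root, of every proof
    -- without a case distinction.
    size : ∀ {C} → Proof C → ℕ
    size π = suc (inner π)

    inner : ∀ {C} → Proof C → ℕ
    inner (axiom _)     = 0
    inner (assume _)    = 0
    inner (infer π ρ _) = size π + size ρ

  incomingAt : ∀ {C} (π : Proof C) → Fin (size π) → Incoming (size π)
  incomingAt (axiom _)     _ = none
  incomingAt (assume _)    _ = none
  incomingAt (infer π ρ _)   = branch (size π) (size ρ)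
    (two (left (size ρ) zero) (right (size π) zero))
    (relocate (left (size ρ)) ∘ incomingAt π) (relocate (right (size π)) ∘ incomingAt ρ)

  labelAt : ∀ {C} (π : Proof C) → Fin (size π) → XorClause p
  labelAt {C} (axiom _)     _ = C
  labelAt {C} (assume _)    _ = C
  labelAt {C} (infer π ρ _)   = branch (size π) (size ρ) C (labelAt π) (labelAt ρ)

  labelAt-root : ∀ {C} (π : Proof C) → labelAt π zero ≡ C
  labelAt-root (axiom _)     = refl
  labelAt-root (assume _)    = refl
  labelAt-root (infer _ _ _) = refl

  -- Injectivity keeps the two sources of an inference distinct.
  relocate-justified : ∀ {m n} {ι : Fin m → Fin n} {L : Fin m → XorClause p} {L′} →
    Injective _≡_ _≡_ ι → (∀ i → L′ (ι i) ≡ L i) →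
    ∀ x {C} → Justified ψ L x C → Justified ψ L′ (relocate ι x) C
  relocate-justified inj eq none      C∈ψ       = C∈ψ
  relocate-justified inj eq (two u v) (u≢v , r) =
    u≢v ∘ inj , subst₂ (λ P C → Rule P C _) (sym (eq u)) (sym (eq v)) r

  module _ {P C D} (π : Proof P) (ρ : Proof C) (r : Rule P C D) where

    incomingAt-left : ∀ i → incomingAt (infer π ρ r) (left (size ρ) i) ≡
                            relocate (left (size ρ)) (incomingAt π i)
    incomingAt-left = branch-left (size π) (size ρ)
      (two (left (size ρ) zero) (right (size π) zero)) _ _

    incomingAt-right : ∀ j → incomingAt (infer π ρ r) (right (size π) j) ≡
                             relocate (right (size π)) (incomingAt ρ j)
    incomingAt-right = branch-right (size π) (size ρ)
      (two (left (size ρ) zero) (right (size π) zero)) _ _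

    labelAt-left : ∀ i → labelAt (infer π ρ r) (left (size ρ) i) ≡ labelAt π i
    labelAt-left = branch-left (size π) (size ρ) D (labelAt π) (labelAt ρ)

    labelAt-right : ∀ j → labelAt (infer π ρ r) (right (size π) j) ≡ labelAt ρ j
    labelAt-right = branch-right (size π) (size ρ) D (labelAt π) (labelAt ρ)

  justifiedAt : ∀ {C} (π : Proof C) v → Justified ψ (labelAt π) (incomingAt π v) (labelAt π v)
  justifiedAt (axiom C∈φ) zero = ∈-++⁺ˡ C∈φ
  justifiedAt (assume i)  zero = ∈-++⁺ʳ φ (∈-map⁺ literal (∈-tabulate⁺ {f = q} i))
  justifiedAt (infer π ρ r) = branch-elim (size π) (size ρ) _
    -- The premises lie in disjoint blocks, so their roots differ even if the two subproofs
    -- coincide.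
    ( left≢right (size π) (size ρ)
    , subst₂ (λ P C → Rule P C _)
        (sym (trans (labelAt-left π ρ r zero) (labelAt-root π)))
        (sym (trans (labelAt-right π ρ r zero) (labelAt-root ρ))) r )
    (λ i → subst₂ (Justified ψ (labelAt (infer π ρ r)))
      (sym (incomingAt-left π ρ r i)) (sym (labelAt-left π ρ r i))
      (relocate-justified (left-injective (size ρ)) (labelAt-left π ρ r)
        (incomingAt π i) (justifiedAt π i)))
    (λ j → subst₂ (Justified ψ (labelAt (infer π ρ r)))
      (sym (incomingAt-right π ρ r j)) (sym (labelAt-right π ρ r j))
      (relocate-justified (right-injective (size π)) (labelAt-right π ρ r)
        (incomingAt ρ j) (justifiedAt ρ j)))

  relocate-above : ∀ {m n} {ι : Fin m → Fin n} → (∀ {i j} → i Fin.< j → ι i Fin.< ι j) →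
    ∀ {v} x → (∀ {u} → u ∈ sources x → v Fin.< u) →
    ∀ {u} → u ∈ sources (relocate ι x) → ι v Fin.< u
  relocate-above mono (two _ _) above (here refl)         = mono (above (here refl))
  relocate-above mono (two _ _) above (there (here refl)) = mono (above (there (here refl)))

  -- Conclusions are numbered before their premises. Every edge of the derivation therefore goes to
  -- a smaller number, which yields acyclicity.
  sources-above : ∀ {C} (π : Proof C) v {u} → u ∈ sources (incomingAt π v) → v Fin.< u
  sources-above (infer π ρ r) = branch-elim (size π) (size ρ) _
    (λ { (here refl) → s≤s z≤n ; (there (here refl)) → s≤s z≤n })
    (λ i {u} u∈ → relocate-above (left-mono-< (size ρ)) (incomingAt π i) (sources-above π i)
      (subst (λ x → u ∈ sources x) (incomingAt-left π ρ r i) u∈))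
    (λ j {u} u∈ → relocate-above (right-mono-< (size π)) (incomingAt ρ j) (sources-above ρ j)
      (subst (λ x → u ∈ sources x) (incomingAt-right π ρ r j) u∈))

  derivation : ∀ {C} → Proof C → UPDerivation ψ
  derivation π = record
    { size      = size π
    ; incoming  = incomingAt π
    ; L         = labelAt π
    ; acyclic   = λ v v⟶⁺v → Fin.<-irrefl refl (descends v⟶⁺v)
    ; justified = justifiedAt π
    }
    where
    descends : ∀ {u v} → TransClosure (λ u v → u ∈ sources (incomingAt π v)) u v → v Fin.< u
    descends Plus.[ u⟶v ]       = sources-above π _ u⟶v
    descends (u⟶w Plus.∷ w⟶⁺v) = Fin.<-trans (descends w⟶⁺v) (sources-above π _ u⟶w)

  -- Parity explanations under the cut below all inputs

  module _ (𝒟 : UPDerivation ψ) where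
    open UPDerivation 𝒟 using (Vertex; incoming; L; Cut; cut; Vₐ; _⟶_; IsInput)

    isNone : ∀ {n} → Incoming n → Bool
    isNone none      = true
    isNone (two _ _) = false

    inputCut : Cut
    inputCut = cut (Vec.tabulate (isNone ∘ incoming))

    input∈Vₐ : ∀ {u} → IsInput u → u Subset.∈ Vₐ inputCut
    input∈Vₐ {u} eq = lookup⇒[]= u _ (trans (lookup∘tabulate (isNone ∘ incoming) u) (cong isNone eq))

    inner∉Vₐ : ∀ {u} → ¬ IsInput u → ¬ u Subset.∈ Vₐ inputCut
    inner∉Vₐ {u} inner u∈Vₐ = inner (isNone⇒none (incoming u)
      (trans (sym (lookup∘tabulate (isNone ∘ incoming) u)) ([]=⇒lookup u∈Vₐ)))
      where
      isNone⇒none : ∀ {n} (x : Incoming n) → isNone x ≡ true → x ≡ none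
      isNone⇒none none _ = refl

    -- The accessibility proofs `rs` depend on `incoming u`. Generalising it to `x` allows the
    -- equation to be matched against `refl`; `explainBy-two` has this form for the same reason.
    explainBy-none : ∀ u x (rs : ∀ {w} → w ∈ sources x → Acc _⟶_ w) → x ≡ none →
      explainBy φ assumptions 𝒟 inputCut u x rs ≡ leafExplanation (L u)
    explainBy-none u none rs refl with L u ∈? φ
    ... | yes _ = refl
    ... | no  _ = refl

    explainBy-two : ∀ u x (rs : ∀ {w} → w ∈ sources x → Acc _⟶_ w) {v w} → x ≡ two v w →
      ¬ u Subset.∈ Vₐ inputCut → ∀ {C D} →
      (∀ a → explain φ assumptions 𝒟 inputCut v a ≡ C) →
      (∀ a → explain φ assumptions 𝒟 inputCut w a ≡ D) →
      explainBy φ assumptions 𝒟 inputCut u x rs ≡ C ⊕ D ⊕ ⊤ᶜ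
    explainBy-two u (two v w) rs refl u∉Vₐ eqv eqw with u ∈ˢ? Vₐ inputCut
    ... | yes u∈Vₐ = contradiction u∈Vₐ u∉Vₐ
    ... | no  _    = cong₂ (λ C D → C ⊕ D ⊕ ⊤ᶜ) (eqv (rs (here refl))) (eqw (rs (there (here refl))))

    -- `explain` always runs in the whole derivation, so the induction on `π` needs an arbitrary
    -- embedding `ι` of its tree into `𝒟`. Quantifying over the accessibility proof `a` avoids
    -- comparing two such proofs.
    explain-embedded : ∀ {C} (π : Proof C) (ι : Fin (size π) → Vertex) →
      (∀ i → incoming (ι i) ≡ relocate ι (incomingAt π i)) → (∀ i → L (ι i) ≡ labelAt π i) →
      ∀ a → explain φ assumptions 𝒟 inputCut (ι zero) a ≡ explanation π
    explain-embedded (axiom {C} C∈φ) ι inc lab (acc rs) =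
      trans (explainBy-none (ι zero) _ rs (inc zero))
        (trans (cong leafExplanation (lab zero))
          (cong (if_then ⊤ᶜ else C) (dec-true (C ∈? φ) C∈φ)))
    explain-embedded (assume i) ι inc lab (acc rs) =
      trans (explainBy-none (ι zero) _ rs (inc zero)) (cong leafExplanation (lab zero))
    explain-embedded (infer π ρ r) ι inc lab (acc rs) =
      explainBy-two (ι zero) _ rs (inc zero) (inner∉Vₐ λ input → two≢none (trans (sym (inc zero)) input))
        (explain-embedded π (ι ∘ left (size ρ))
          (λ i → trans (inc (left (size ρ) i))
            (trans (cong (relocate ι) (incomingAt-left π ρ r i))
              (relocate-∘ ι (left (size ρ)) (incomingAt π i))))
          (λ i → trans (lab (left (size ρ) i)) (labelAt-left π ρ r i)))
        (explain-embedded ρ (ι ∘ right (size π))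
          (λ j → trans (inc (right (size π) j))
            (trans (cong (relocate ι) (incomingAt-right π ρ r j))
              (relocate-∘ ι (right (size π)) (incomingAt ρ j))))
          (λ j → trans (lab (right (size π) j)) (labelAt-right π ρ r j)))

  Expl⊕-root : ∀ {C} (π : Proof C) →
    Expl⊕ φ assumptions (derivation π) zero (inputCut (derivation π)) ≡ explanation π
  Expl⊕-root π = explain-embedded (derivation π) π id
    (λ i → sym (relocate-id (incomingAt π i))) (λ _ → refl)
    (UPDerivation.⟶-wellFounded (derivation π) zero)

-- Parity graphs

separated : ∀ {A : Set} (h : A → Bool) {x y} → h x ≡ true → h y ≡ false → x ≢ y
separated h hx hy refl = not-¬ hx hy

-- Supplies a root. The empty sum is `false`, so there is a node; the one returned may have either
-- charge.
some-index : ∀ {n} (h : Fin n → Bool) → ∑ (allFin n) h ≡ true → Fin n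
some-index {suc n} _ _ = zero

module Parity {p : ℕ} (G : ParityGraph p) where
  open ParityGraph G

  Node Edge : Set
  Node = Fin #nodes
  Edge = Fin #edges

  source target : Edge → Node
  source = proj₁ ∘ ends
  target = proj₂ ∘ ends

  incidence : Node → Edge → Bool
  incidence v e = δ v (source e) xor δ v (target e)

  -- An edge has two different ends, so the exclusive or in `incidence` never cancels and agrees
  -- with the disjunction in `Incident`.
  does-incident? : ∀ v e → does (incident? v e) ≡ incidence v e
  does-incident? v e with v ≟ source e | v ≟ target e
  ... | yes refl | yes eq = contradiction eq (loopless e)
  ... | yes _    | no _   = refl
  ... | no _     | yes _  = refl
  ... | no _     | no _   = refl

  Incident⇒incidence : ∀ {v e} → Incident v e → incidence v e ≡ true
  Incident⇒incidence {v} {e} inc = trans (sym (does-incident? v e)) (dec-true (incident? v e) inc)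

  ∑-incident-δ : ∀ v e → ∑[ f ← incidentEdges v ] δ f e ≡ incidence v e
  ∑-incident-δ v e = trans (∑-filter-δ (incident? v) e) (does-incident? v e)

  module _ {ev : XorClause p → Bool} (linear : Linear ev) where
    open Linear linear

    ev-chargeLiteral : ∀ v → ev (literal (chargeLiteral v)) ≡ charge v ∧ ev ⊤ᶜ
    ev-chargeLiteral v with charge v
    ... | true  = refl
    ... | false = trans (ev-⊕ ⊤ᶜ ⊤ᶜ) (xor-same (ev ⊤ᶜ))

    ev-totalCharge : ev totalCharge ≡ ∑ (allFin #nodes) charge ∧ ev ⊤ᶜ
    ev-totalCharge = begin
      ev (⨁ (map literal (tabulate chargeLiteral)))
        ≡⟨ cong (ev ∘ ⨁ ∘ map literal) (sym (map-tabulate id chargeLiteral)) ⟩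
      ev (⨁ (map literal (map chargeLiteral (allFin _))))
        ≡⟨ ev-⨁ literal (map chargeLiteral (allFin _)) ⟩
      ∑ (map chargeLiteral (allFin _)) (ev ∘ literal)
        ≡⟨ ∑-map chargeLiteral (ev ∘ literal) (allFin _) ⟩
      ∑ (allFin _) (ev ∘ literal ∘ chargeLiteral)
        ≡⟨ ∑-cong ev-chargeLiteral (allFin _) ⟩
      ∑ (allFin _) (λ v → charge v ∧ ev ⊤ᶜ)
        ≡⟨ ∑-∧ charge (ev ⊤ᶜ) (allFin _) ⟩
      ∑ (allFin _) charge ∧ ev ⊤ᶜ ∎
      where open ≡-Reasoning

    ev-α : ∀ v → ev (α v) ≡ (∑[ e ← incidentEdges v ] ev Subset.⁅ var (label e) ⁆)
                            xor ((charge v xor true) ∧ ev ⊤ᶜ)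
    ev-α v = begin
      ev (α v)
        ≡⟨ ev-⨁ literal (map edgeLiteral es ++ chargeLiteral v ∷ pos ⊤ᵃ ∷ []) ⟩
      ∑ (map edgeLiteral es ++ chargeLiteral v ∷ pos ⊤ᵃ ∷ []) (ev ∘ literal)
        ≡⟨ ∑-++ (ev ∘ literal) (map edgeLiteral es) _ ⟩
      ∑ (map edgeLiteral es) (ev ∘ literal) xor
        (ev (literal (chargeLiteral v)) xor (ev ⊤ᶜ xor false))
        ≡⟨ cong₂ _xor_ (∑-map edgeLiteral (ev ∘ literal) es)
             (cong (_xor (ev ⊤ᶜ xor false)) (ev-chargeLiteral v)) ⟩
      s xor ((charge v ∧ ev ⊤ᶜ) xor (ev ⊤ᶜ xor false))
        ≡⟨ cong (s xor_) (solve 2 (λ c t → c :* t :+ (t :+ con false) := (c :+ con true) :* t)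
             refl (charge v) (ev ⊤ᶜ)) ⟩
      s xor ((charge v xor true) ∧ ev ⊤ᶜ) ∎
      where
      open ≡-Reasoning
      es : List Edge
      es = incidentEdges v
      edgeLiteral : Edge → Literal p
      edgeLiteral e = pos (var (label e))
      s : Bool
      s = ∑[ e ← es ] ev Subset.⁅ var (label e) ⁆

  lookup-α : ∀ v a → lookup (α v) a ≡ (∑[ e ← incidentEdges v ] δ (var (label e)) a)
                                      xor ((charge v xor true) ∧ δ ⊤ᵃ a)
  lookup-α v a = trans (ev-α (lookup-linear a) v)
    (cong₂ (λ b c → b xor ((charge v xor true) ∧ c))
      (∑-cong (λ e → lookup-⁅⁆ (var (label e)) a) (incidentEdges v)) (lookup-⁅⁆ ⊤ᵃ a))

  -- Labels are distinct, so no two edge variables cancel in the normal form of `α v`.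
  lookup-α-label : ∀ v e → lookup (α v) (var (label e)) ≡ incidence v e
  lookup-α-label v e = begin
    lookup (α v) (var (label e))
      ≡⟨ lookup-α v (var (label e)) ⟩
    ∑ (incidentEdges v) (λ f → δ (label f) (label e)) xor ((charge v xor true) ∧ false)
      ≡⟨ solve 2 (λ s c → s :+ c :* con false := s) refl _ (charge v xor true) ⟩
    ∑ (incidentEdges v) (λ f → δ (label f) (label e))
      ≡⟨ ∑-cong (λ f → δ-injective label-inj f e) (incidentEdges v) ⟩
    ∑ (incidentEdges v) (λ f → δ f e)
      ≡⟨ ∑-incident-δ v e ⟩
    incidence v e ∎
    where open ≡-Reasoning

  -- Edge values and the nodes they violate

  defect : (Edge → Bool) → Node → Bool
  defect τ v = charge v xor ∑ (incidentEdges v) τ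

  -- Each edge contributes to the defects of its two ends.
  ∑-defect : ∀ τ → ∑ (allFin #nodes) (defect τ) ≡ ∑ (allFin #nodes) charge
  ∑-defect τ = begin
    ∑ vs (defect τ)
      ≡⟨ ∑-xor charge (λ v → ∑ (incidentEdges v) τ) vs ⟩
    ∑ vs charge xor ∑ vs (λ v → ∑ (incidentEdges v) τ)
      ≡⟨ cong (∑ vs charge xor_) (∑-cong expand vs) ⟩
    ∑ vs charge xor ∑ vs (λ v → ∑ es (λ e → (δ v (source e) ∧ τ e) xor (δ v (target e) ∧ τ e)))
      ≡⟨ cong (∑ vs charge xor_) (∑-comm _ vs es) ⟩
    ∑ vs charge xor ∑ es (λ e → ∑ vs (λ v → (δ v (source e) ∧ τ e) xor (δ v (target e) ∧ τ e)))
      ≡⟨ cong (∑ vs charge xor_) (trans (∑-cong twice es) (∑-false es)) ⟩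
    ∑ vs charge xor false
      ≡⟨ xor-identityʳ _ ⟩
    ∑ vs charge ∎
    where
    open ≡-Reasoning
    vs : List Node
    vs = allFin #nodes
    es : List Edge
    es = allFin #edges
    expand : ∀ v → ∑ (incidentEdges v) τ ≡
                   ∑ es (λ e → (δ v (source e) ∧ τ e) xor (δ v (target e) ∧ τ e))
    expand v = trans (∑-filter (incident? v) τ es) (∑-cong (λ e →
      trans (cong (_∧ τ e) (does-incident? v e))
        (∧-distribʳ-xor (τ e) (δ v (source e)) (δ v (target e)))) es)
    twice : ∀ e → ∑ vs (λ v → (δ v (source e) ∧ τ e) xor (δ v (target e) ∧ τ e)) ≡ false
    twice e = trans (∑-xor (λ v → δ v (source e) ∧ τ e) (λ v → δ v (target e) ∧ τ e) vs)
      (trans (cong₂ _xor_ (∑-δ (source e) (λ _ → τ e)) (∑-δ (target e) (λ _ → τ e)))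
        (xor-same (τ e)))

  ∑-charge : totalCharge ≡ ⊤ᶜ → ∑ (allFin #nodes) charge ≡ true
  ∑-charge eq = trans (sym (∧-identityʳ _))
    (trans (sym (ev-totalCharge (lookup-linear ⊤ᵃ))) (cong (λ C → lookup C ⊤ᵃ) eq))

  -- The defects sum to the total charge, which is odd. This parity count gives both the
  -- unsatisfiability and the violation at the root.
  not-all-balanced : totalCharge ≡ ⊤ᶜ → ∀ τ → ¬ (∀ v → defect τ v ≡ false)
  not-all-balanced eq τ balanced =
    not-¬ (trans (∑-defect τ) (∑-charge eq))
      (trans (∑-cong balanced (allFin #nodes)) (∑-false (allFin #nodes)))

  -- The truth value of `α v` is the negation of the defect at `v`: the summand `⊤` in `α v` turns
  -- the sum of the charge and the edge values around.
  satisfied⇒balanced : ∀ {τ v} → τ ⊨ᶜ α v → defect (lookup τ ∘ label) v ≡ false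
  satisfied⇒balanced {τ} {v} sat = begin
    charge v xor s
      ≡⟨ solve 2 (λ c s → c :+ s := (s :+ (c :+ con true) :* con true) :+ con true) refl
           (charge v) s ⟩
    (s xor ((charge v xor true) ∧ true)) xor true
      ≡⟨ cong (_xor true) (cong₂ (λ b c → b xor ((charge v xor true) ∧ c))
           (sym (∑-cong (λ e → value-⁅⁆ τ (var (label e))) (incidentEdges v)))
           (sym (value-⁅⁆ τ ⊤ᵃ))) ⟩
    ((∑[ e ← incidentEdges v ] value τ Subset.⁅ var (label e) ⁆)
      xor ((charge v xor true) ∧ value τ ⊤ᶜ)) xor true
      ≡⟨ cong (_xor true) (sym (ev-α (value-linear τ) v)) ⟩
    value τ (α v) xor true
      ≡⟨ cong (_xor true) (⊨ᶜ⇒value {C = α v} sat) ⟩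
    false ∎
    where
    open ≡-Reasoning
    s : Bool
    s = ∑ (incidentEdges v) (lookup τ ∘ label)

  -- Read along the labels, a satisfying assignment would be a choice of edge values that balances
  -- every node.
  unsatisfiable : totalCharge ≡ ⊤ᶜ → Unsatisfiable xorclauses
  unsatisfiable eq (τ , sat) = not-all-balanced eq (lookup τ ∘ label)
    (λ v → satisfied⇒balanced {τ} {v} (All.tabulate⁻ {f = α} sat v))

  defect-flip : ∀ τ e v → defect (λ f → τ f xor δ f e) v ≡ defect τ v xor incidence v e
  defect-flip τ e v = trans (cong (charge v xor_)
      (trans (∑-xor τ (λ f → δ f e) (incidentEdges v))
        (cong (∑ (incidentEdges v) τ xor_) (∑-incident-δ v e))))
    (sym (xor-assoc (charge v) (∑ (incidentEdges v) τ) (incidence v e)))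

  incidence-ends : ∀ {u v e} → ends e ≡ (u , v) ⊎ ends e ≡ (v , u) →
                   ∀ w → incidence w e ≡ δ w u xor δ w v
  incidence-ends (inj₁ eq) w rewrite eq = refl
  incidence-ends {u} {v} (inj₂ eq) w rewrite eq = xor-comm (δ w v) (δ w u)

  -- Flipping an edge changes the defects of its two ends. Along a path the changes at intermediate
  -- nodes cancel, also when nodes or edges repeat.
  flipPath : ∀ {u v} → Star Adjacent u v → ∀ τ →
             ∃[ τ′ ] (∀ w → defect τ′ w ≡ defect τ w xor (δ w u xor δ w v))
  flipPath ε τ =
    τ , λ w → solve 2 (λ a b → a := a :+ (b :+ b)) refl (defect τ w) (δ w _)
  flipPath {u} {v} (_◅_ {j = x} (e , joins) path) τ
    with τ′ , eq ← flipPath path (λ f → τ f xor δ f e) =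
    τ′ , λ w → trans (eq w) (trans
      (cong (_xor (δ w x xor δ w v))
        (trans (defect-flip τ e w) (cong (defect τ w xor_) (incidence-ends joins w))))
      (solve 4 (λ d a b c → (d :+ (a :+ b)) :+ (b :+ c) := d :+ (a :+ c)) refl
        (defect τ w) (δ w u) (δ w x) (δ w v)))

  -- Flipping a path from an unbalanced node `v` to `r` moves its defect to `r` and changes no other
  -- defect, so nodes treated earlier stay balanced.
  balance : ∀ r vs → ∃[ τ ] All (λ v → v ≢ r → defect τ v ≡ false) vs
  balance r []       = (λ _ → false) , []
  balance r (v ∷ vs) with balance r vs
  ... | τ , bal with v ≟ r | defect τ v in d
  ...   | yes v≡r | _     = τ , contradiction v≡r ∷ bal
  ...   | no _    | false = τ , (λ _ → d) ∷ bal
  ...   | no v≢r  | true  with τ′ , eq ← flipPath (connected v r) τ =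
    τ′ , fixed ∷ All.map (λ {w} → preserved {w}) bal
    where
    fixed : v ≢ r → defect τ′ v ≡ false
    fixed v≢r = trans (eq v)
      (cong₂ _xor_ d (cong₂ _xor_ (dec-true (v ≟ v) refl) (dec-false (v ≟ r) v≢r)))
    preserved : ∀ {w} → (w ≢ r → defect τ w ≡ false) → w ≢ r → defect τ′ w ≡ false
    preserved {w} ih w≢r with w ≟ v
    ... | yes refl = fixed w≢r
    ... | no  w≢v  = trans (eq w)
      (cong₂ _xor_ (ih w≢r) (cong₂ _xor_ (dec-false (w ≟ v) w≢v) (dec-false (w ≟ r) w≢r)))

  end-incident : ∀ {u v e} → ends e ≡ (u , v) ⊎ ends e ≡ (v , u) → Incident v e
  end-incident (inj₁ eq) = inj₂ (sym (cong proj₂ eq))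
  end-incident (inj₂ eq) = inj₁ (sym (cong proj₁ eq))

  -- A node other than the source of `e₀` is joined to it by a path, and the first edge of that path
  -- is incident to the node.
  touches : Edge → ∀ v → ∃[ e ] Incident v e
  touches e₀ v with v ≟ source e₀
  ... | yes eq = e₀ , inj₁ eq
  ... | no  v≢ with connected v (source e₀)
  ...   | ε               = contradiction refl v≢
  ...   | (e , joins) ◅ _ = e , end-incident (swap joins)

  -- Propagation of the assumed literals at one node

  module _ (τ : Edge → Bool) where

    q : Edge → Literal p
    q e = signed (τ e) (label e)

    open Refutations xorclauses q

    -- The coordinate at a of q e ⊕ ⊤, which resolving against q e adds to a clause.
    weight : Atom p → Edge → Bool
    weight a e = δ (var (label e)) a xor (τ e ∧ δ ⊤ᵃ a)

    record Resolvent {C} (π : Proof C) (es : List Edge) : Set where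
      field
        clause        : XorClause p
        proof         : Proof clause
        lookup-clause : ∀ a → lookup clause a ≡ lookup C a xor ∑ es (weight a)
        uses-proof    : ∀ f → uses proof f ≡ uses π f xor (∑[ e ← es ] δ e f)

    -- Each inference requires its variable to be still present. Resolving on another edge changes
    -- only the coordinates of that edge's label and of `⊤ᵃ`, and the edges of `es` are distinct.
    resolveAll : ∀ {C} (π : Proof C) {es} → Unique es →
      All (λ e → lookup C (var (label e)) ≡ true) es → Resolvent π es
    resolveAll π [] [] = record
      { proof         = π
      ; lookup-clause = λ _ → sym (xor-identityʳ _)
      ; uses-proof    = λ _ → sym (xor-identityʳ _)
      }
    resolveAll {C} π {e ∷ es} (e∉es ∷ unique) (e∈C ∷ es⊆C) = record
      { proof         = infer (assume e) ρ (rule (τ e) (label e) e∈D)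
      ; lookup-clause = eq
      ; uses-proof    = λ f → trans (cong (δ e f xor_) (uses-ρ f))
          (solve 3 (λ a b c → a :+ (b :+ c) := b :+ (a :+ c)) refl
            (δ e f) (uses π f) (∑[ e′ ← es ] δ e′ f))
      }
      where
      open Resolvent (resolveAll π unique es⊆C)
        renaming (clause to D; proof to ρ; lookup-clause to lookup-D; uses-proof to uses-ρ)
      open ≡-Reasoning
      unweighted : ∀ {f} → e ≢ f → weight (var (label e)) f ≡ false
      unweighted {f} e≢f = cong₂ _xor_
        (trans (δ-injective label-inj f e) (dec-false (f ≟ e) (e≢f ∘ sym)))
        (∧-zeroʳ (τ f))
      e∈D : var (label e) Subset.∈ D
      e∈D = lookup⇒[]= _ D (trans (lookup-D _)
        (cong₂ _xor_ e∈C (∑-all-false (All.map unweighted e∉es))))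
      eq : ∀ a → lookup (literal (q e) ⊕ D ⊕ ⊤ᶜ) a ≡ lookup C a xor ∑ (e ∷ es) (weight a)
      eq a = begin
        lookup (literal (q e) ⊕ D ⊕ ⊤ᶜ) a
          ≡⟨ trans (lookup-⊕ a (literal (q e)) _) (cong (lookup (literal (q e)) a xor_) (lookup-⊕ a D ⊤ᶜ)) ⟩
        lookup (literal (q e)) a xor (lookup D a xor lookup ⊤ᶜ a)
          ≡⟨ cong₂ _xor_ (lookup-signed (τ e) (label e) a)
               (cong₂ _xor_ (lookup-D a) (lookup-⁅⁆ ⊤ᵃ a)) ⟩
        (x xor ((τ e xor true) ∧ t)) xor ((lookup C a xor ∑ es (weight a)) xor t)
          ≡⟨ solve 5 (λ x τ t c s → (x :+ (τ :+ con true) :* t) :+ ((c :+ s) :+ t) :=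
                                    c :+ ((x :+ τ :* t) :+ s)) refl
               x (τ e) t (lookup C a) (∑ es (weight a)) ⟩
        lookup C a xor ((x xor (τ e ∧ t)) xor ∑ es (weight a)) ∎
        where
        x t : Bool
        x = δ (var (label e)) a
        t = δ ⊤ᵃ a

    -- Resolving on all edges at `v` cancels every variable and leaves the truth value of `α v`
    -- under `τ` as a constant: the empty clause at a violated node, `⊤ᶜ` at a balanced one.
    lookup-α-weight : ∀ v a → lookup (α v) a xor ∑ (incidentEdges v) (weight a) ≡
                              (defect τ v xor true) ∧ δ ⊤ᵃ a
    lookup-α-weight v a = begin
      lookup (α v) a xor ∑ es (weight a)
        ≡⟨ cong₂ _xor_ (lookup-α v a)
             (trans (∑-xor (λ e → δ (var (label e)) a) (λ e → τ e ∧ t) es)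
               (cong (s xor_) (∑-∧ τ t es))) ⟩
      (s xor ((charge v xor true) ∧ t)) xor (s xor (∑ es τ ∧ t))
        ≡⟨ solve 4 (λ s c t τ → (s :+ (c :+ con true) :* t) :+ (s :+ τ :* t) :=
                                ((c :+ τ) :+ con true) :* t) refl
             s (charge v) t (∑ es τ) ⟩
      (defect τ v xor true) ∧ t ∎
      where
      open ≡-Reasoning
      es : List Edge
      es = incidentEdges v
      s t : Bool
      s = ∑[ e ← es ] δ (var (label e)) a
      t = δ ⊤ᵃ a

    node : ∀ v → Proof (α v)
    node v = axiom (∈-tabulate⁺ {f = α} v)

    incidentEdges-unique : ∀ v → Unique (incidentEdges v)
    incidentEdges-unique v = filter⁺ (incident? v) (allFin⁺ #edges)

    incident-in-α : ∀ v {e} → e ∈ incidentEdges v → lookup (α v) (var (label e)) ≡ true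
    incident-in-α v {e} e∈ = trans (lookup-α-label v e)
      (Incident⇒incidence (proj₂ (∈-filter⁻ (incident? v) {xs = allFin #edges} e∈)))

    refute : ∀ r → defect τ r ≡ true →
             Σ[ π ∈ Proof ⊥ᶜ ] (∀ f → uses π f ≡ incidence r f)
    refute r violated =
      subst Proof D≡⊥ π , λ f → trans (uses-subst D≡⊥ π f) (trans (uses-π f) (∑-incident-δ r f))
      where
      open Resolvent (resolveAll (node r) (incidentEdges-unique r) (All.tabulate (incident-in-α r)))
        renaming (clause to D; proof to π; lookup-clause to lookup-D; uses-proof to uses-π)
      D≡⊥ : D ≡ ⊥ᶜ
      D≡⊥ = lookup-ext λ a → trans (lookup-D a)
        (trans (lookup-α-weight r a)
          (trans (cong (λ b → (b xor true) ∧ δ ⊤ᵃ a) violated)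
            (sym (lookup-replicate a false))))

    -- Resolving on all edges at a balanced node would give `⊤ᶜ`. Leaving out `e` adds its weight
    -- once more, that is, `literal (q e) ⊕ ⊤ᶜ`, and the two constants cancel. For `f` equal to `e`
    -- the count is even.
    propagate : ∀ {w e} → Incident w e → defect τ w ≡ false →
                Σ[ π ∈ Proof (literal (q e)) ] (∀ f → uses π f ≡ incidence w f xor δ e f)
    propagate {w} {e} inc balanced =
      subst Proof D≡q π , λ f → trans (uses-subst D≡q π f) (trans (uses-π f)
        (trans (∑-remove (incident? w) e (λ g → δ g f) w∋e)
          (cong (_xor δ e f) (∑-incident-δ w f))))
      where
      open ≡-Reasoning
      open Resolvent (resolveAll (node w) (filter⁺ (λ f → ¬? (f ≟ e)) (incidentEdges-unique w))
          (All.tabulate λ f∈ → incident-in-α w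
            (proj₁ (∈-filter⁻ (λ f → ¬? (f ≟ e)) {xs = incidentEdges w} f∈))))
        renaming (clause to D; proof to π; lookup-clause to lookup-D; uses-proof to uses-π)
      w∋e : does (incident? w e) ≡ true
      w∋e = dec-true (incident? w e) inc
      D≡q : D ≡ literal (q e)
      D≡q = lookup-ext λ a → begin
        lookup D a
          ≡⟨ trans (lookup-D a) (cong (lookup (α w) a xor_)
               (∑-remove (incident? w) e (weight a) w∋e)) ⟩
        lookup (α w) a xor (∑ (incidentEdges w) (weight a) xor weight a e)
          ≡⟨ sym (xor-assoc (lookup (α w) a) _ _) ⟩
        (lookup (α w) a xor ∑ (incidentEdges w) (weight a)) xor weight a e
          ≡⟨ cong (_xor weight a e) (trans (lookup-α-weight w a)
               (cong (λ b → (b xor true) ∧ δ ⊤ᵃ a) balanced)) ⟩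
        δ ⊤ᵃ a xor (δ (var (label e)) a xor (τ e ∧ δ ⊤ᵃ a))
          ≡⟨ solve 3 (λ t x τ → t :+ (x :+ τ :* t) := x :+ (τ :+ con true) :* t) refl
               (δ ⊤ᵃ a) (δ (var (label e)) a) (τ e) ⟩
        δ (var (label e)) a xor ((τ e xor true) ∧ δ ⊤ᵃ a)
          ≡⟨ sym (lookup-signed (τ e) (label e) a) ⟩
        lookup (literal (q e)) a ∎

    -- Growing the explored set of nodes

    record Explored (r : Node) (S : Node → Bool) : Set where
      field
        refutation : Proof ⊥ᶜ
        root∈S     : S r ≡ true
        -- The citation parities form the coboundary of `S` modulo 2, which vanishes once `S`
        -- contains every node.
        boundary   : ∀ f → uses refutation f ≡ S (source f) xor S (target f)

    open Explored

    module _ (r : Node) (violated : defect τ r ≡ true)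
             (balanced : ∀ v → v ≢ r → defect τ v ≡ false) where

      start : Explored r (λ v → δ v r)
      start = record
        { refutation = proj₁ (refute r violated)
        ; root∈S     = dec-true (r ≟ r) refl
        ; boundary   = λ f → trans (proj₂ (refute r violated) f)
            (cong₂ _xor_ (δ-sym r (source f)) (δ-sym r (target f)))
        }

      Extension : (Node → Bool) → Node → Set
      Extension S w = ∃[ S′ ] Explored r S′ × S′ w ≡ true × (∀ v → S v ≡ true → S′ v ≡ true)

      advance : ∀ {S u w} → Explored r S → S u ≡ true → Adjacent u w → Extension S w
      advance {S} {u} {w} E u∈S (e , joins) with S w in w?
      ... | true  = S , E , w? , λ _ → id
      ... | false =
        S′ , record
          { refutation = substitute e ρ (refutation E)
          ; root∈S     = S⊆S′ r (root∈S E)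
          ; boundary   = bound
          } , cong₂ _xor_ w? (dec-true (w ≟ w) refl) , S⊆S′
        where
        open ≡-Reasoning
        derived : Σ[ ρ ∈ Proof (literal (q e)) ] (∀ f → uses ρ f ≡ incidence w f xor δ e f)
        -- The root lies in `S` and `w` does not, so `w` differs from `r` and is balanced.
        derived = propagate (end-incident joins) (balanced w (separated S (root∈S E) w? ∘ sym))
        ρ : Proof (literal (q e))
        ρ = proj₁ derived
        uses-ρ : ∀ f → uses ρ f ≡ incidence w f xor δ e f
        uses-ρ = proj₂ derived
        -- As `w` is outside `S`, the exclusive or adds it to the set; in this form the new boundary
        -- is the old one plus the edges at `w`.
        S′ : Node → Bool
        S′ v = S v xor δ v w
        S⊆S′ : ∀ v → S v ≡ true → S′ v ≡ true
        S⊆S′ v v∈S = cong₂ _xor_ v∈S (dec-false (v ≟ w) (separated S v∈S w?))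
        crossing : ends e ≡ (u , w) ⊎ ends e ≡ (w , u) → S (source e) xor S (target e) ≡ true
        crossing (inj₁ eq) rewrite eq = cong₂ _xor_ u∈S w?
        crossing (inj₂ eq) rewrite eq = cong₂ _xor_ w? u∈S
        -- As e is cited oddly often, the substitution adds exactly the edges at w.
        bound : ∀ f → uses (substitute e ρ (refutation E)) f ≡ S′ (source f) xor S′ (target f)
        bound f = begin
          uses (substitute e ρ (refutation E)) f
            ≡⟨ uses-substitute e ρ (refutation E) f ⟩
          uses (refutation E) f xor (uses (refutation E) e ∧ (δ e f xor uses ρ f))
            ≡⟨ cong₂ (λ b c → b xor (c ∧ (δ e f xor uses ρ f)))
                 (boundary E f) (trans (boundary E e) (crossing joins)) ⟩
          (S (source f) xor S (target f)) xor (δ e f xor uses ρ f)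
            ≡⟨ cong (λ b → (S (source f) xor S (target f)) xor (δ e f xor b)) (uses-ρ f) ⟩
          (S (source f) xor S (target f)) xor
            (δ e f xor ((δ w (source f) xor δ w (target f)) xor δ e f))
            ≡⟨ cong₂ (λ b c → (S (source f) xor S (target f)) xor (δ e f xor ((b xor c) xor δ e f)))
                 (δ-sym w (source f)) (δ-sym w (target f)) ⟩
          (S (source f) xor S (target f)) xor
            (δ e f xor ((δ (source f) w xor δ (target f) w) xor δ e f))
            ≡⟨ solve 5 (λ s t a b c → (s :+ t) :+ (c :+ ((a :+ b) :+ c)) := (s :+ a) :+ (t :+ b)) refl
                 (S (source f)) (S (target f)) (δ (source f) w) (δ (target f) w) (δ e f) ⟩
          S′ (source f) xor S′ (target f) ∎

      walk : ∀ {S u v} → Explored r S → S u ≡ true → Star Adjacent u v → Extension S v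
      walk E u∈S ε = _ , E , u∈S , λ _ → id
      walk E u∈S (adj ◅ path)
        with S₁ , E₁ , w∈S₁ , S⊆S₁ ← advance E u∈S adj
        with S₂ , E₂ , v∈S₂ , S₁⊆S₂ ← walk E₁ w∈S₁ path =
        S₂ , E₂ , v∈S₂ , λ v → S₁⊆S₂ v ∘ S⊆S₁ v

      -- The root stays in the set throughout, so every further node can be reached by a path
      -- starting from `r`; since extensions only enlarge the set, nodes reached earlier remain.
      exploreAll : ∀ vs → ∃[ S ] Explored r S × All (λ v → S v ≡ true) vs
      exploreAll []       = _ , start , []
      exploreAll (v ∷ vs)
        with S₁ , E₁ , vs∈S₁ ← exploreAll vs
        with S₂ , E₂ , v∈S₂ , S₁⊆S₂ ← walk E₁ (root∈S E₁) (connected r v) =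
        S₂ , E₂ , v∈S₂ ∷ All.map (λ {w} → S₁⊆S₂ w) vs∈S₁

      evenRefutation : Σ[ π ∈ Proof ⊥ᶜ ] (∀ f → uses π f ≡ false)
      evenRefutation =
        let S , E , all∈S = exploreAll (allFin #nodes) in
        refutation E , λ f → trans (boundary E f)
          (cong₂ _xor_ (All.lookup all∈S (∈-allFin (source f))) (All.lookup all∈S (∈-allFin (target f))))

    -- Once there is an edge, every `α v` contains a variable, as does every assumption, so no input
    -- is labelled `⊥ᶜ`. The edge matters: for a single node of charge `⊤` without edges, `α v` is
    -- itself `⊥ᶜ`.
    root-inner : ∀ {C} (π : Proof C) → C ≡ ⊥ᶜ → 0 < #edges → incomingAt π zero ≢ none
    root-inner (axiom C∈) C≡⊥ 0<#edges _ =
      let v , C≡α = ∈-tabulate⁻ {f = α} C∈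
          e , inc = touches (fromℕ< 0<#edges) v
      in not-¬ (trans (lookup-α-label v e) (Incident⇒incidence inc))
           (trans (cong (λ C → lookup C (var (label e))) (trans (sym C≡α) C≡⊥))
             (lookup-replicate (label e) false))
    root-inner (assume e) C≡⊥ _ _ = not-¬
      (trans (lookup-signed (τ e) (label e) (var (label e)))
        (cong₂ _xor_ (dec-true (label e ≟ label e) refl) (∧-zeroʳ (τ e xor true))))
      (trans (cong (λ C → lookup C (var (label e))) C≡⊥) (lookup-replicate (label e) false))

    assumptions-valid : All (IsAssumption xorclauses) assumptions
    assumptions-valid = All.tabulate⁺ λ e → label e , atom-signed (τ e) (label e) ,
      Any.tabulate⁺ (source e)
        (lookup⇒[]= _ _ (trans (lookup-α-label (source e) e) (Incident⇒incidence (inj₁ refl))))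
      where
      atom-signed : ∀ b x → atom (signed b x) ≡ var x
      atom-signed true  x = refl
      atom-signed false x = refl

  -- Assembling the refutation and its cut

  root-violated : totalCharge ≡ ⊤ᶜ → ∀ {τ r} → (∀ v → v ≢ r → defect τ v ≡ false) →
                  defect τ r ≡ true
  root-violated charged {τ} {r} balanced with defect τ r in d
  ... | true  = refl
  ... | false = ⊥-elim (not-all-balanced charged τ all-balanced)
    where
    all-balanced : ∀ v → defect τ v ≡ false
    all-balanced v with v ≟ r
    ... | yes refl = d
    ... | no  v≢r  = balanced v v≢r

  refutable : totalCharge ≡ ⊤ᶜ → ∃[ τ ] Σ[ π ∈ Refutations.Proof xorclauses (q τ) ⊥ᶜ ]
              (∀ f → Refutations.uses xorclauses (q τ) π f ≡ false)
  refutable charged =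
    let r = some-index charge (∑-charge charged)
        τ , all-balanced = balance r (allFin #nodes)
        balanced = λ v → All.lookup all-balanced (∈-allFin v)
    in τ , evenRefutation τ r (root-violated charged balanced) balanced

  explainedRefutation : totalCharge ≡ ⊤ᶜ →
    Σ[ qs ∈ List (Literal p) ]
    All (IsAssumption xorclauses) qs ×
    (Σ[ 𝒟 ∈ UPDerivation (xorclauses ∧ᵃ qs) ]
    let open UPDerivation 𝒟 in
    IsRefutation ×
    (Σ[ v ∈ Vertex ] Σ[ W ∈ Cut ]
    L v ≡ ⊥ᶜ ×
    (0 < #edges → W IsCutFor v) ×
    Expl⊕ xorclauses qs 𝒟 v W ≡ ⊤ᶜ))
  explainedRefutation charged =
    assumptions , assumptions-valid τ , derivation π ,
    (zero , labelAt-root π) , zero , inputCut (derivation π) , labelAt-root π ,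
    (λ 0<#edges → record
      { nonInput = root-inner τ π refl 0<#edges
      ; v∈V_b    = x∉p⇒x∈∁p (inner∉Vₐ (derivation π) (root-inner τ π refl 0<#edges))
      ; inputs   = λ u input _ → input∈Vₐ (derivation π) input
      }) ,
    trans (Expl⊕-root π) (explanation-even π (proj₂ (proj₂ (refutable charged))))
    where
    τ : Edge → Bool
    τ = proj₁ (refutable charged)
    open Refutations xorclauses (q τ)
    π : Proof ⊥ᶜ
    π = proj₁ (proj₂ (refutable charged))

theorem3 : ∀ {p : ℕ} (G : ParityGraph p) → let open ParityGraph G in
    totalCharge ≡ ⊤ᶜ →
    (Σ[ qs ∈ List (Literal p) ]
    All (IsAssumption xorclauses) qs ×
    (Σ[ 𝒟 ∈ UPDerivation (xorclauses ∧ᵃ qs) ]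
    let open UPDerivation 𝒟 in
    IsRefutation ×
    (Σ[ v ∈ Vertex ] Σ[ W ∈ Cut ]
    L v ≡ ⊥ᶜ ×
    (0 < #edges → W IsCutFor v) ×
    Expl⊕ xorclauses qs 𝒟 v W ≡ ⊤ᶜ)))
    × xorclauses ⊨ ⊤ᶜ ⇔ᶠ ⊥ᶜ
    × Unsatisfiable xorclauses
theorem3 G charged =
  explainedRefutation charged ,
  -- No assignment satisfies the conjunction, so the equivalence holds vacuously.
  (λ τ sat → ⊥-elim (unsatisfiable charged (τ , sat))) ,
  unsatisfiable charged
  where open Parity G
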